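{- Let $\overrightarrow{W}$ be a Morse sequence on a simplicial complex $K$. Then $\overline\Phi_p=\widetilde\curlywedge_p\circ\curlywedge_p$ and $\underline\Phi_p=\widetilde\curlyvee_p\circ\curlyvee_p$ as maps $K[p]\to K[p]$, for every $p$.
   Context: A simplicial complex $K$ is a finite collection of non-empty finite sets closed under taking non-empty subsets; $\dim\sigma=|\sigma|-1$, $K^{(p)}$ the set of $p$-simplices. A pair $(\sigma,\tau)$ with $\sigma\subsetneq\tau$ is a free pair for $K$ if $\tau$ is the only simplex other than $\sigma$ containing $\sigma$; $K$ is then an elementary expansion of $K\setminus\{\sigma,\tau\}$. If $\nu$ is a facet (maximal simplex) of $K$, $K$ is an elementary filling of $K\setminus\{\nu\}$. A Morse sequence on $K$ is a sequence $\langle\emptyset=K_0,\dots,K_k=K\rangle$ with each $K_i$ an elementary expansion or filling of $K_{i-1}$; simplices added by fillings are critical; for an expansion $K_i=K_{i-1}\cup\{\sigma,\tau\}$, $\sigma\subset\tau$, $(\sigma,\tau)$ is a regular pair, $\sigma$ lower regular, $\tau$ upper regular. $\widehat W$ is the set of critical simplices. $K[p]$ is the $\mathbb{Z}_2$-vector space of subsets of $K^{(p)}$ (sum = symmetric difference, $0=\emptyset$), $\widehat W[p]=\{c\in K[p]:c\subseteq\widehat W\}$. For $\sigma\in K^{(p)}$, $\partial(\sigma)=\{\tau\in K^{(p-1)}:\tau\subset\sigma\}$, $\delta(\sigma)=\{\tau\in K^{(p+1)}:\sigma\subset\tau\}$, with linear extensions $\partial_p,\delta_p$. The reference map $\curlywedge$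 is the unique map assigning to each $p$-simplex an element of $\widehat W[p]$, with linear extension $\curlywedge_p$, such that $\curlywedge(\nu)=\{\nu\}$ for critical $\nu$ and $\curlywedge(\tau)=0=\curlywedge(\partial(\tau))$ for upper regular $\tau$; the coreference map $\curlyvee$ (linear extension $\curlyvee_p$) is the unique such map with $\curlyvee(\nu)=\{\nu\}$ for critical $\nu$ and $\curlyvee(\sigma)=0=\curlyvee(\delta(\sigma))$ for lower regular $\sigma$. Extension maps: $\widetilde\curlywedge_p,\widetilde\curlyvee_p:\widehat W[p]\to K[p]$ linear with $\widetilde\curlywedge(\kappa)=\{\nu\in K:\kappa\in\curlyvee(\nu)\}$, $\widetilde\curlyvee(\kappa)=\{\nu\in K:\kappa\in\curlywedge(\nu)\}$ for critical $\kappa$. Let $V_p:K[p]\to K[p+1]$ and $V^*_p:K[p]\to K[p-1]$ be the linear maps with $V(\kappa)=V^*(\kappa)=0$ for critical $\kappa$, and $V(\sigma)=\tau$, $V(\tau)=0$, $V^*(\sigma)=0$, $V^*(\tau)=\sigma$ for each regular pair $(\sigma,\tau)$. The gradient flow $\Phi_p:K[p]\to K[p]$ and coflow $\Phi^*_p:K[p]\to K[p]$ are the linear maps with $\Phi_p(\nu)=\nu+\partial_{p+1}(V_p(\nu))+V_{p-1}(\partial_p(\nu))$ and $\Phi^*_p(\nu)=\nu+\delta_{p-1}(V^*_p(\nu))+V^*_{p+1}(\delta_p(\nu))$ for $\nu\in K^{(p)}$. For each $c\in K[p]$ there are integers $i,j\ge0$ with $\Phi^{i+1}(c)=\Phi^i(c)$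 and $(\Phi^*)^{j+1}(c)=(\Phi^*)^j(c)$; one sets $\overline\Phi_p(c)=\Phi^i(c)$ and $\underline\Phi_p(c)=(\Phi^*)^j(c)$. -}

module Defs where

open import Data.Bool using (Bool; true; false; T; _∧_; _xor_)
open import Data.Bool.Properties as Bool using (T-∧)
open import Data.Empty using (⊥)
open import Data.Fin using (Fin; zero; suc)
import Data.Fin.Subset as Sub
open Sub using (Subset; inside; outside; ∣_∣; Nonempty; _⊆_; _⊂_; _∪_; ⁅_⁆)
open import Data.Fin.Subset.Properties using (_⊆?_; p⊆p∪q; q⊆p∪q; x∈p∪q⁻; x∈⁅x⁆; x∈⁅y⁆⇒x≡y; ∪-identityʳ)
open import Data.Integer as ℤ using (ℤ; +_; pred)
import Data.Integer.Properties as ℤ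
open import Data.List using (List; []; _∷_; map; _++_; foldr)
open import Data.Nat as ℕ using (ℕ; zero; suc)
open import Data.Nat.GeneralisedArithmetic using (fold)
open import Data.Product using (∃-syntax; _×_; _,_; proj₁; proj₂)
open import Data.Sum using (_⊎_; inj₁; inj₂; [_,_]′)
open import Data.Vec using ([]; _∷_; here; there)
open import Data.Vec.Properties using (≡-dec)
open import Function using (Equivalence; _⇔_; _∘_)
open import Relation.Binary.Definitions using (DecidableEquality)
open import Relation.Binary.PropositionalEquality using (_≡_; _≢_; _≗_; refl; sym; trans; cong; subst)
open import Relation.Nullary using (¬_; Dec; does; yes; no; contradiction)
open import Relation.Nullary.Decidable using (_×-dec_; _⊎-dec_)

private variable n : ℕ

-- The vertices are labelled by Fin n, so a finite set of vertices is a
-- Subset n, and a collection of such sets is given by its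
-- characteristic function.
Coll : ℕ → Set
Coll n = Subset n → Bool

infix 4 _∈_ _⊑_
infixl 6 _△_

_∈_ : Subset n → Coll n → Set
σ ∈ C = T (C σ)

_⊑_ : Coll n → Coll n → Set
C ⊑ D = ∀ {σ} → σ ∈ C → σ ∈ D

_≟_ : DecidableEquality (Subset n)
_≟_ = ≡-dec Bool._≟_

∅ : Coll n
∅ _ = false

singleton : Subset n → Coll n
singleton σ τ = does (τ ≟ σ)

_△_ : Coll n → Coll n → Coll n
(C △ D) σ = C σ xor D σ

dim : Subset n → ℤ
dim σ = pred (+ ∣ σ ∣)

infix 9 _⁽_⁾

_⁽_⁾ : Coll n → ℤ → Coll n
(C ⁽ p ⁾) σ = C σ ∧ does (dim σ ℤ.≟ p)

allSubsets : ∀ n → List (Subset n)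
allSubsets zero    = [] ∷ []
allSubsets (suc n) = map (outside ∷_) (allSubsets n) ++ map (inside ∷_) (allSubsets n)

parity : List Bool → Bool
parity = foldr _xor_ false

-- The ℤ₂-linear extension of f: the sum of the f σ for σ ∈ c.
extend : (Subset n → Coll n) → Coll n → Coll n
extend {n} f c τ = parity (map (λ σ → c σ ∧ f σ τ) (allSubsets n))

-- The ℤ₂-vector space of subsets of S.
record Chain (S : Coll n) : Set where
  constructor chain
  field
    coeff   : Coll n
    support : coeff ⊑ S

open Chain public

infix 4 _≈_
infixl 6 _⊕_

_≈_ : {S : Coll n} → Chain S → Chain S → Set
c ≈ d = coeff c ≗ coeff d

_⊕_ : {S : Coll n} → Chain S → Chain S → Chain S
_⊕_ {S = S} c d = chain (coeff c △ coeff d) (λ {σ} → supp σ)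
  where
  supp : ∀ σ → T (coeff c σ xor coeff d σ) → σ ∈ S
  supp σ t with coeff c σ in eq
  ... | true  = support c (subst T (sym eq) _)
  ... | false = support d t

-- g is the map f̄ sending each c to the value f^i(c) at which the iterates
-- of f on c become stationary. Such a g is unique up to _≈_, and the
-- existence of i for each c is part of the assertion.
_StabilisesTo_ : {S : Coll n} → (f g : Chain S → Chain S) → Set
f StabilisesTo g = ∀ c → ∃[ i ] (fold c f (suc i) ≈ fold c f i × g c ≈ fold c f i)

extend-support : (f : Subset n → Coll n) {S : Coll n} (c : Coll n) →
                 (∀ {σ} → σ ∈ c → f σ ⊑ S) → extend f c ⊑ S
extend-support {n} f {S} c f⊑S {τ} = go (allSubsets n)
  where
  go : ∀ σs → T (parity (map (λ σ → c σ ∧ f σ τ) σs)) → τ ∈ S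
  go (σ ∷ σs) t with c σ in cσ | f σ τ in fστ
  ... | true  | true  = f⊑S (subst T (sym cσ) _) (subst T (sym fστ) _)
  ... | true  | false = go σs t
  ... | false | _     = go σs t

linear : {S S′ : Coll n} (f : Subset n → Coll n) →
         (∀ {σ} → σ ∈ S → f σ ⊑ S′) → Chain S → Chain S′
linear f f⊑S′ c = chain (extend f (coeff c)) (extend-support f (coeff c) (f⊑S′ ∘ support c))

record Complex (n : ℕ) : Set where
  field
    simplices : Coll n
    nonempty  : ∀ {σ} → σ ∈ simplices → Nonempty σ
    closed    : ∀ {σ τ} → σ ∈ simplices → τ ⊆ σ → Nonempty τ → τ ∈ simplices

open Complex public

infix 9 _[_]

_[_] : Complex n → ℤ → Set
K [ p ] = Chain (simplices K ⁽ p ⁾)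

recast : (K : Complex n) {p q : ℤ} → p ≡ q → K [ p ] → K [ q ]
recast K p≡q c = chain (coeff c) (λ {σ} → subst (λ r → σ ∈ simplices K ⁽ r ⁾) p≡q ∘ support c)

record FreePair (K : Complex n) (σ τ : Subset n) : Set where
  field
    σ∈K  : σ ∈ simplices K
    τ∈K  : τ ∈ simplices K
    σ⊂τ  : σ ⊂ τ
    only : ∀ {ν} → ν ∈ simplices K → σ ⊆ ν → ν ≢ σ → ν ≡ τ

record Facet (K : Complex n) (ν : Subset n) : Set where
  field
    ν∈K     : ν ∈ simplices K
    maximal : ∀ {μ} → μ ∈ simplices K → ν ⊆ μ → μ ≡ ν

record Expansion (L K : Complex n) (σ τ : Subset n) : Set where
  field
    free   : FreePair K σ τ
    remove : ∀ ν → ν ∈ simplices L ⇔ (ν ∈ simplices K × ν ≢ σ × ν ≢ τ)   -- L = K ∖ {σ , τ}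

record Filling (L K : Complex n) (κ : Subset n) : Set where
  field
    facet  : Facet K κ
    remove : ∀ ν → ν ∈ simplices L ⇔ (ν ∈ simplices K × ν ≢ κ)   -- L = K ∖ {κ}

data MorseSequence {n} : Complex n → Set where
  start  : ∀ {K} → (∀ σ → ¬ σ ∈ simplices K) → MorseSequence K
  expand : ∀ {L K} → MorseSequence L → ∀ σ τ → Expansion L K σ τ → MorseSequence K
  fill   : ∀ {L K} → MorseSequence L → ∀ κ → Filling L K κ → MorseSequence K

Critical : {K : Complex n} → MorseSequence K → Subset n → Set
Critical (start _)        ν = ⊥
Critical (expand W _ _ _) ν = Critical W ν
Critical (fill W κ _)     ν = ν ≡ κ ⊎ Critical W ν

RegularPair : {K : Complex n} → MorseSequence K → Subset n → Subset n → Set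
RegularPair (start _)        ρ ν = ⊥
RegularPair (expand W σ τ _) ρ ν = (ρ ≡ σ × ν ≡ τ) ⊎ RegularPair W ρ ν
RegularPair (fill W _ _)     ρ ν = RegularPair W ρ ν

LowerRegular UpperRegular : {K : Complex n} → MorseSequence K → Subset n → Set
LowerRegular W σ = ∃[ τ ] RegularPair W σ τ
UpperRegular W τ = ∃[ σ ] RegularPair W σ τ

critical? : {K : Complex n} (W : MorseSequence K) (ν : Subset n) → Dec (Critical W ν)
critical? (start _)        ν = no λ ()
critical? (expand W _ _ _) ν = critical? W ν
critical? (fill W κ _)     ν = ν ≟ κ ⊎-dec critical? W ν

regularPair? : {K : Complex n} (W : MorseSequence K) (σ τ : Subset n) → Dec (RegularPair W σ τ)
regularPair? (start _)        ρ ν = no λ ()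
regularPair? (expand W σ τ _) ρ ν = (ρ ≟ σ ×-dec ν ≟ τ) ⊎-dec regularPair? W ρ ν
regularPair? (fill W _ _)     ρ ν = regularPair? W ρ ν

Ŵ : {K : Complex n} → MorseSequence K → Coll n
Ŵ W ν = does (critical? W ν)

Ŵ⁽_⁾ : {K : Complex n} → MorseSequence K → ℤ → Coll n
Ŵ⁽_⁾ {K = K} W p ν = (simplices K ⁽ p ⁾) ν ∧ Ŵ W ν

-- Ŵ[p] = { c ∈ K[p] : c ⊆ Ŵ }
Ŵ[_] : {K : Complex n} → MorseSequence K → ℤ → Set
Ŵ[ W ] p = Chain (Ŵ⁽ W ⁾ p)

∧⁻ : ∀ {a b} → T (a ∧ b) → T a × T b
∧⁻ = Equivalence.to T-∧

∧⁺ : ∀ {a b} → T a → T b → T (a ∧ b)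
∧⁺ s t = Equivalence.from T-∧ (s , t)

witness⁺ : ∀ {A : Set} (a? : Dec A) → A → T (does a?)
witness⁺ (yes _) _ = _
witness⁺ (no ¬a) a = contradiction a ¬a

witness⁻ : ∀ {A : Set} (a? : Dec A) → T (does a?) → A
witness⁻ (yes a) _ = a

graded⁺ : ∀ (C : Coll n) {p} σ → σ ∈ C → dim σ ≡ p → σ ∈ C ⁽ p ⁾
graded⁺ C {p} σ σ∈C e = ∧⁺ {C σ} σ∈C (witness⁺ (dim σ ℤ.≟ p) e)

graded⁻ : ∀ (C : Coll n) {p} σ → σ ∈ C ⁽ p ⁾ → σ ∈ C × dim σ ≡ p
graded⁻ C {p} σ t with ∧⁻ {C σ} t
... | σ∈C , e = σ∈C , witness⁻ (dim σ ℤ.≟ p) e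

∣p∪⁅x⁆∣ : ∀ (p : Subset n) {x} → ¬ x Sub.∈ p → ∣ p ∪ ⁅ x ⁆ ∣ ≡ suc ∣ p ∣
∣p∪⁅x⁆∣ (true  ∷ p) {zero}  x∉p = contradiction here x∉p
∣p∪⁅x⁆∣ (false ∷ p) {zero}  x∉p = cong (suc ∘ ∣_∣) (∪-identityʳ p)
∣p∪⁅x⁆∣ (true  ∷ p) {suc x} x∉p = cong suc (∣p∪⁅x⁆∣ p (x∉p ∘ there))
∣p∪⁅x⁆∣ (false ∷ p) {suc x} x∉p = ∣p∪⁅x⁆∣ p (x∉p ∘ there)

dim-suc : ∀ {σ τ : Subset n} → ∣ τ ∣ ≡ suc ∣ σ ∣ → dim τ ≡ ℤ.suc (dim σ)
dim-suc {σ = σ} e = trans (cong (pred ∘ +_) e) (sym (ℤ.suc-pred (+ ∣ σ ∣)))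

freePair-dim : {K : Complex n} {σ τ : Subset n} → FreePair K σ τ → dim τ ≡ ℤ.suc (dim σ)
freePair-dim {n} {K} {σ} {τ} fp with FreePair.σ⊂τ fp
... | σ⊆τ , x , x∈τ , x∉σ = dim-suc {σ = σ} {τ} (trans (cong ∣_∣ (sym ρ≡τ)) (∣p∪⁅x⁆∣ σ x∉σ))
  where
  open FreePair fp
  ρ : Subset n
  ρ = σ ∪ ⁅ x ⁆
  x∈ρ : x Sub.∈ ρ
  x∈ρ = q⊆p∪q σ ⁅ x ⁆ (x∈⁅x⁆ x)
  ρ⊆τ : ρ ⊆ τ
  ρ⊆τ y∈ρ = [ σ⊆τ , (λ y∈⁅x⁆ → subst (Sub._∈ τ) (sym (x∈⁅y⁆⇒x≡y x y∈⁅x⁆)) x∈τ) ]′ (x∈p∪q⁻ σ ⁅ x ⁆ y∈ρ)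
  ρ≡τ : ρ ≡ τ
  ρ≡τ = only (closed K τ∈K ρ⊆τ (x , x∈ρ)) (p⊆p∪q ⁅ x ⁆) (λ ρ≡σ → x∉σ (subst (x Sub.∈_) ρ≡σ x∈ρ))

regularPair-graded : {K : Complex n} (W : MorseSequence K) {σ τ : Subset n} → RegularPair W σ τ →
                     σ ∈ simplices K × τ ∈ simplices K × dim τ ≡ ℤ.suc (dim σ)
regularPair-graded (expand W σ τ e) (inj₁ (refl , refl)) = FreePair.σ∈K fp , FreePair.τ∈K fp , freePair-dim fp
  where fp = Expansion.free e
regularPair-graded (expand W _ _ e) (inj₂ r) with regularPair-graded W r
... | σ∈L , τ∈L , d = proj₁ (Equivalence.to (Expansion.remove e _) σ∈L) , proj₁ (Equivalence.to (Expansion.remove e _) τ∈L) , d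
regularPair-graded (fill W _ f) r with regularPair-graded W r
... | σ∈L , τ∈L , d = proj₁ (Equivalence.to (Filling.remove f _) σ∈L) , proj₁ (Equivalence.to (Filling.remove f _) τ∈L) , d

∂ δ : Complex n → Subset n → Coll n
∂ K σ τ = (simplices K ⁽ pred  (dim σ) ⁾) τ ∧ does (τ ⊆? σ)
δ K σ τ = (simplices K ⁽ ℤ.suc (dim σ) ⁾) τ ∧ does (σ ⊆? τ)

∂ₚ : (K : Complex n) (p : ℤ) → K [ p ] → K [ pred p ]
∂ₚ K p = linear (∂ K) λ {σ} σ∈ {τ} τ∈ →
  subst (λ q → τ ∈ simplices K ⁽ pred q ⁾) (proj₂ (graded⁻ (simplices K) σ σ∈))
        (proj₁ (∧⁻ {(simplices K ⁽ pred (dim σ) ⁾) τ} τ∈))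

δₚ : (K : Complex n) (p : ℤ) → K [ p ] → K [ ℤ.suc p ]
δₚ K p = linear (δ K) λ {σ} σ∈ {τ} τ∈ →
  subst (λ q → τ ∈ simplices K ⁽ ℤ.suc q ⁾) (proj₂ (graded⁻ (simplices K) σ σ∈))
        (proj₁ (∧⁻ {(simplices K ⁽ ℤ.suc (dim σ) ⁾) τ} τ∈))

module _ {K : Complex n} (W : MorseSequence K) where

  -- Each simplex of K is critical or lies in exactly one regular pair, so
  -- V σ is {τ} if (σ , τ) is a regular pair and empty if σ is critical or
  -- upper regular; V* is the transpose.
  V V* : Subset n → Coll n
  V  σ τ = does (regularPair? W σ τ)
  V* τ σ = does (regularPair? W σ τ)

  Vₚ : ∀ p → K [ p ] → K [ ℤ.suc p ]
  Vₚ p = linear V λ {σ} σ∈ {τ} r →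
    let _ , τ∈K , d = regularPair-graded W (witness⁻ (regularPair? W σ τ) r)
    in graded⁺ (simplices K) τ τ∈K (trans d (cong ℤ.suc (proj₂ (graded⁻ (simplices K) σ σ∈))))

  V*ₚ : ∀ p → K [ p ] → K [ pred p ]
  V*ₚ p = linear V* λ {τ} τ∈ {σ} r →
    let σ∈K , _ , d = regularPair-graded W (witness⁻ (regularPair? W σ τ) r)
    in graded⁺ (simplices K) σ σ∈K (trans (sym (ℤ.pred-suc (dim σ)))
         (cong pred (trans (sym d) (proj₂ (graded⁻ (simplices K) τ τ∈)))))

  -- The formulas for Φ ν and Φ* ν, written on arbitrary chains; all the maps
  -- involved are linear, so this is the linear extension from simplices.
  Φ Φ* : ∀ p → K [ p ] → K [ p ]
  Φ  p c = c ⊕ recast K (ℤ.pred-suc p) (∂ₚ K (ℤ.suc p) (Vₚ p c))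
             ⊕ recast K (ℤ.suc-pred p) (Vₚ (pred p) (∂ₚ K p c))
  Φ* p c = c ⊕ recast K (ℤ.suc-pred p) (δₚ K (pred p) (V*ₚ p c))
             ⊕ recast K (ℤ.pred-suc p) (V*ₚ (ℤ.suc p) (δₚ K p c))

  private
    transpose-graded : ∀ {f : Subset n → Coll n} →
      (∀ {p ν} → ν ∈ simplices K ⁽ p ⁾ → f ν ⊑ Ŵ⁽ W ⁾ p) →
      ∀ {p κ} → κ ∈ Ŵ⁽ W ⁾ p → (λ ν → simplices K ν ∧ f ν κ) ⊑ simplices K ⁽ p ⁾
    transpose-graded {f} value {p} {κ} κ∈ {ν} t with ∧⁻ {simplices K ν} t
    ... | ν∈K , κ∈fν = graded⁺ (simplices K) ν ν∈K (trans (sym κ-dim-ν) κ-dim-p)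
      where
      κ-dim-p : dim κ ≡ p
      κ-dim-p = proj₂ (graded⁻ (simplices K) κ (proj₁ (∧⁻ {(simplices K ⁽ p ⁾) κ} κ∈)))
      κ-dim-ν : dim κ ≡ dim ν
      κ-dim-ν = proj₂ (graded⁻ (simplices K) κ (proj₁ (∧⁻ {(simplices K ⁽ dim ν ⁾) κ}
                  (value (graded⁺ (simplices K) ν ν∈K refl) κ∈fν))))

  -- Only the values of ⋏ and ⋎ on the simplices of K are meaningful.
  record IsReference (⋏ : Subset n → Coll n) : Set where
    field
      value    : ∀ {p σ} → σ ∈ simplices K ⁽ p ⁾ → ⋏ σ ⊑ Ŵ⁽ W ⁾ p
      critical : ∀ {ν} → Critical W ν → ⋏ ν ≗ singleton ν
      upper    : ∀ {τ} → UpperRegular W τ → ⋏ τ ≗ ∅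
      upper-∂  : ∀ {τ} → UpperRegular W τ → extend ⋏ (∂ K τ) ≗ ∅

  record IsCoreference (⋎ : Subset n → Coll n) : Set where
    field
      value    : ∀ {p σ} → σ ∈ simplices K ⁽ p ⁾ → ⋎ σ ⊑ Ŵ⁽ W ⁾ p
      critical : ∀ {ν} → Critical W ν → ⋎ ν ≗ singleton ν
      lower    : ∀ {σ} → LowerRegular W σ → ⋎ σ ≗ ∅
      lower-δ  : ∀ {σ} → LowerRegular W σ → extend ⋎ (δ K σ) ≗ ∅

  module _ {⋏ : Subset n → Coll n} (ref : IsReference ⋏) where

    ⋏ₚ : ∀ p → K [ p ] → Ŵ[ W ] p
    ⋏ₚ p = linear ⋏ (IsReference.value ref)

    -- ⋎~ κ = { ν ∈ K : κ ∈ ⋏ ν }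
    ⋎~ₚ : ∀ p → Ŵ[ W ] p → K [ p ]
    ⋎~ₚ p = linear (λ κ ν → simplices K ν ∧ ⋏ ν κ) (transpose-graded (IsReference.value ref))

  module _ {⋎ : Subset n → Coll n} (coref : IsCoreference ⋎) where

    ⋎ₚ : ∀ p → K [ p ] → Ŵ[ W ] p
    ⋎ₚ p = linear ⋎ (IsCoreference.value coref)

    -- ⋏~ κ = { ν ∈ K : κ ∈ ⋎ ν }
    ⋏~ₚ : ∀ p → Ŵ[ W ] p → K [ p ]
    ⋏~ₚ p = linear (λ κ ν → simplices K ν ∧ ⋎ ν κ) (transpose-graded (IsCoreference.value coref))

{-# OPTIONS --safe #-}

-- Over ℤ₂ the coflow Φ* is the transpose of the flow Φ, and ⋏~, ⋎~ are the
-- transposes of ⋎, ⋏. The defining properties of ⋏ and ⋎ give ⋏ ∘ Φ = ⋏ and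
-- ⋎ ∘ Φ* = ⋎, hence by transposition Φ ∘ ⋏~ = ⋏~; moreover ⋏ ∘ ⋏~ = id. So it
-- suffices that Φ is nilpotent on ker ⋏. Let h be the number of regular pairs.
-- Going down the Morse sequence, each application of Φ removes the lower regular
-- simplices of the latest remaining pair, so Φ^h c has no lower regular simplex.
-- On such chains ⋏ reads off the critical part, so if ⋏ c = 0 only upper regular
-- simplices remain, and h further steps remove these in the same way. Hence
-- Φ^2h = ⋏~ ∘ ⋏, and the identity for Φ* is its transpose.
module Submission where

open import Defs
open import Algebra.Bundles using (CommutativeRing)
import Algebra.Properties.CommutativeSemigroup as CommutativeSemigroupProperties
open import Data.Bool using (Bool; true; false; T; _∧_; _xor_)
open import Data.Bool.Properties using (∧-assoc; ∧-comm; ∧-identityʳ; ∧-distribˡ-xor; ∧-distribʳ-xor; xor-assoc; xor-same; xor-identityʳ; xor-∧-commutativeRing)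
open import Data.Fin.Subset using (Subset; inside; outside; _⊆_)
open import Data.Fin.Subset.Properties using (_⊆?_)
open import Data.Integer as ℤ using (ℤ; pred)
import Data.Integer.Properties as ℤ
open import Data.List using (List; []; _∷_; map; _++_)
open import Data.List.Properties using (map-++; map-∘; map-cong)
open import Data.Nat using (ℕ; zero; suc; _+_; _≤_; _<_; z≤n)
open import Data.Nat.GeneralisedArithmetic using (fold)
open import Data.Nat.Properties using (≤-trans; <-asym; <⇒≱; m≤n⇒m≤1+n; m≤n+m; m≤m+n; n<1+n; +-suc; ≤-<-trans)
open import Data.Product using (_×_; _,_; proj₁; proj₂)
open import Data.Sum using (_⊎_; inj₁; inj₂)
open import Data.Vec using ([]; _∷_)
open import Data.Vec.Properties using (∷-injectiveʳ)
open import Function using (_∘_; Equivalence; flip)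
open import Relation.Binary.PropositionalEquality using (_≡_; _≢_; _≗_; refl; sym; trans; cong; cong₂; subst; module ≡-Reasoning)
open import Relation.Nullary using (¬_; yes; no; contradiction)
open import Relation.Nullary.Decidable using (dec-true)

open CommutativeSemigroupProperties (CommutativeRing.+-commutativeSemigroup xor-∧-commutativeRing)
  using () renaming (interchange to xor-interchange; xy∙z≈xz∙y to xor-swapʳ)
open ≡-Reasoning

private variable
  n : ℕ
  A B : Set

-- Finite sums over ℤ₂

¬T⇒false : ∀ {b} → ¬ T b → b ≡ false
¬T⇒false {true}  ¬t = contradiction _ ¬t
¬T⇒false {false} _  = refl

T⇒true : ∀ {b} → T b → b ≡ true
T⇒true {true} _ = refl

false⇒¬T : ∀ {b} → b ≡ false → ¬ T b
false⇒¬T refl ()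

T-ext : ∀ {a b} → (T a → T b) → (T b → T a) → a ≡ b
T-ext {true}  {b} f _ = sym (T⇒true (f _))
T-ext {false} {b} _ g = sym (¬T⇒false g)

∧-cong-T : ∀ {a b c} → (T a → b ≡ c) → a ∧ b ≡ a ∧ c
∧-cong-T {true}  e = e _
∧-cong-T {false} _ = refl

xor≡false⇒≡ : ∀ a b → a xor b ≡ false → a ≡ b
xor≡false⇒≡ true  true  _ = refl
xor≡false⇒≡ false b     e = sym e

∑ : (Subset n → Bool) → Bool
∑ {n} f = parity (map f (allSubsets n))

∑-cong : {f g : Subset n → Bool} → f ≗ g → ∑ f ≡ ∑ g
∑-cong {n} f≗g = cong parity (map-cong f≗g (allSubsets n))

parity-false : (xs : List A) → parity (map (λ _ → false) xs) ≡ false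
parity-false []       = refl
parity-false (_ ∷ xs) = parity-false xs

parity-xor : (f g : A → Bool) (xs : List A) →
             parity (map (λ x → f x xor g x) xs) ≡ parity (map f xs) xor parity (map g xs)
parity-xor f g []       = refl
parity-xor f g (x ∷ xs) = trans (cong ((f x xor g x) xor_) (parity-xor f g xs))
                                (xor-interchange (f x) (g x) _ _)

parity-∧ : (b : Bool) (f : A → Bool) (xs : List A) →
           parity (map (λ x → b ∧ f x) xs) ≡ b ∧ parity (map f xs)
parity-∧ true  f xs = refl
parity-∧ false f xs = parity-false xs

parity-swap : (f : A → B → Bool) (xs : List A) (ys : List B) →
              parity (map (λ x → parity (map (f x) ys)) xs) ≡
              parity (map (λ y → parity (map (λ x → f x y) xs)) ys)
parity-swap f []       ys = sym (parity-false ys)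
parity-swap f (x ∷ xs) ys = trans (cong (parity (map (f x) ys) xor_) (parity-swap f xs ys))
                                  (sym (parity-xor (f x) _ ys))

parity-++ : ∀ xs ys → parity (xs ++ ys) ≡ parity xs xor parity ys
parity-++ []       ys = refl
parity-++ (x ∷ xs) ys = trans (cong (x xor_) (parity-++ xs ys)) (sym (xor-assoc x _ _))

∑-zero : (f : Subset n → Bool) → (∀ σ → ¬ T (f σ)) → ∑ f ≡ false
∑-zero {n} f ¬f = trans (∑-cong (λ σ → ¬T⇒false (¬f σ))) (parity-false (allSubsets n))

∑-suc : (f : Subset (suc n) → Bool) → ∑ f ≡ ∑ (f ∘ (outside ∷_)) xor ∑ (f ∘ (inside ∷_))
∑-suc {n} f = begin
  parity (map f (map (outside ∷_) xs ++ map (inside ∷_) xs))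
    ≡⟨ cong parity (map-++ f (map (outside ∷_) xs) _) ⟩
  parity (map f (map (outside ∷_) xs) ++ map f (map (inside ∷_) xs))
    ≡⟨ parity-++ (map f (map (outside ∷_) xs)) _ ⟩
  parity (map f (map (outside ∷_) xs)) xor parity (map f (map (inside ∷_) xs))
    ≡⟨ cong₂ (λ a b → parity a xor parity b) (sym (map-∘ xs)) (sym (map-∘ xs)) ⟩
  ∑ (f ∘ (outside ∷_)) xor ∑ (f ∘ (inside ∷_)) ∎
  where xs = allSubsets n

-- Induction on the vertices: the half of the subsets that disagrees with `ρ` at the first vertex
-- sums to zero.
∑-single : (f : Subset n → Bool) (ρ : Subset n) → (∀ σ → T (f σ) → σ ≡ ρ) → ∑ f ≡ f ρ
∑-single f []            _ = xor-identityʳ (f [])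
∑-single f (outside ∷ ρ) only = begin
  ∑ f                                          ≡⟨ ∑-suc f ⟩
  ∑ (f ∘ (outside ∷_)) xor ∑ (f ∘ (inside ∷_)) ≡⟨ cong₂ _xor_ (∑-single _ ρ λ σ t → ∷-injectiveʳ (only _ t))
                                                              (∑-zero (f ∘ (inside ∷_)) λ σ t → contradiction (only (inside ∷ σ) t) λ ()) ⟩
  f (outside ∷ ρ) xor false                    ≡⟨ xor-identityʳ _ ⟩
  f (outside ∷ ρ)                              ∎
∑-single f (inside ∷ ρ) only = begin
  ∑ f                                          ≡⟨ ∑-suc f ⟩
  ∑ (f ∘ (outside ∷_)) xor ∑ (f ∘ (inside ∷_)) ≡⟨ cong₂ _xor_ (∑-zero (f ∘ (outside ∷_)) λ σ t → contradiction (only (outside ∷ σ) t) λ ())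
                                                              (∑-single _ ρ λ σ t → ∷-injectiveʳ (only _ t)) ⟩
  f (inside ∷ ρ)                               ∎

-- Linear extensions and the pairing

extend-cong : (f : Subset n → Coll n) {c d : Coll n} → c ≗ d → extend f c ≗ extend f d
extend-cong f c≗d τ = ∑-cong λ σ → cong (_∧ f σ τ) (c≗d σ)

extend-△ : (f : Subset n → Coll n) (c d : Coll n) → extend f (c △ d) ≗ extend f c △ extend f d
extend-△ {n} f c d τ = trans (∑-cong λ σ → ∧-distribʳ-xor (f σ τ) (c σ) (d σ))
                             (parity-xor (λ σ → c σ ∧ f σ τ) _ (allSubsets n))

extend-∅ : (f : Subset n → Coll n) (c : Coll n) {τ : Subset n} →
           (∀ {σ} → σ ∈ c → ¬ τ ∈ f σ) → extend f c τ ≡ false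
extend-∅ f c ¬f = ∑-zero _ λ σ t → let σ∈c , τ∈fσ = ∧⁻ {c σ} t in ¬f σ∈c τ∈fσ

extend-single : (f : Subset n → Coll n) (c : Coll n) {τ : Subset n} (ρ : Subset n) →
                (∀ {σ} → σ ∈ c → τ ∈ f σ → σ ≡ ρ) → extend f c τ ≡ c ρ ∧ f ρ τ
extend-single f c ρ only = ∑-single _ ρ λ σ t → let σ∈c , τ∈fσ = ∧⁻ {c σ} t in only σ∈c τ∈fσ

infix 8 ⟨_,_⟩

⟨_,_⟩ : Coll n → Coll n → Bool
⟨ c , d ⟩ = ∑ λ σ → c σ ∧ d σ

pair-cong : {c c′ d d′ : Coll n} → c ≗ c′ → d ≗ d′ → ⟨ c , d ⟩ ≡ ⟨ c′ , d′ ⟩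
pair-cong c≗ d≗ = ∑-cong λ σ → cong₂ _∧_ (c≗ σ) (d≗ σ)

pair-comm : (c d : Coll n) → ⟨ c , d ⟩ ≡ ⟨ d , c ⟩
pair-comm c d = ∑-cong λ σ → ∧-comm (c σ) (d σ)

pair-△ˡ : (c d e : Coll n) → ⟨ c △ d , e ⟩ ≡ ⟨ c , e ⟩ xor ⟨ d , e ⟩
pair-△ˡ {n} c d e = trans (∑-cong λ σ → ∧-distribʳ-xor (e σ) (c σ) (d σ))
                          (parity-xor (λ σ → c σ ∧ e σ) _ (allSubsets n))

pair-△ʳ : (c d e : Coll n) → ⟨ c , d △ e ⟩ ≡ ⟨ c , d ⟩ xor ⟨ c , e ⟩
pair-△ʳ {n} c d e = trans (∑-cong λ σ → ∧-distribˡ-xor (c σ) (d σ) (e σ))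
                          (parity-xor (λ σ → c σ ∧ d σ) _ (allSubsets n))

pair-singleton : (c : Coll n) (ν : Subset n) → ⟨ c , singleton ν ⟩ ≡ c ν
pair-singleton c ν = begin
  ⟨ c , singleton ν ⟩  ≡⟨ ∑-single _ ν (λ σ t → witness⁻ (σ ≟ ν) (proj₂ (∧⁻ {c σ} t))) ⟩
  c ν ∧ singleton ν ν  ≡⟨ cong (c ν ∧_) (dec-true (ν ≟ ν) refl) ⟩
  c ν ∧ true           ≡⟨ ∧-identityʳ (c ν) ⟩
  c ν                  ∎

-- Terms outside the supports vanish, so `f` and `g` need only be transposes on `c` and `d`. This
-- matters for `∂ K` and `δ K`: each tests only its second argument for membership in `K`, so they
-- are transposes between simplices of `K` alone.
extend-adjoint : {f g : Subset n → Coll n} (c d : Coll n) →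
                 (∀ {σ τ} → σ ∈ c → τ ∈ d → f σ τ ≡ g τ σ) →
                 ⟨ extend f c , d ⟩ ≡ ⟨ c , extend g d ⟩
extend-adjoint {n} {f} {g} c d f≡g = begin
  ∑ (λ τ → extend f c τ ∧ d τ)           ≡⟨ ∑-cong (λ τ → trans (∧-comm _ (d τ)) (sym (parity-∧ (d τ) _ xs))) ⟩
  ∑ (λ τ → ∑ λ σ → d τ ∧ (c σ ∧ f σ τ))  ≡⟨ parity-swap (λ τ σ → d τ ∧ (c σ ∧ f σ τ)) xs xs ⟩
  ∑ (λ σ → ∑ λ τ → d τ ∧ (c σ ∧ f σ τ))  ≡⟨ ∑-cong (λ σ → ∑-cong λ τ → transposed σ τ) ⟩
  ∑ (λ σ → ∑ λ τ → c σ ∧ (d τ ∧ g τ σ))  ≡⟨ ∑-cong (λ σ → parity-∧ (c σ) _ xs) ⟩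
  ∑ (λ σ → c σ ∧ extend g d σ)           ∎
  where
  xs = allSubsets n
  transposed : ∀ σ τ → d τ ∧ (c σ ∧ f σ τ) ≡ c σ ∧ (d τ ∧ g τ σ)
  transposed σ τ = begin
    d τ ∧ (c σ ∧ f σ τ) ≡⟨ ∧-cong-T {d τ} (λ τ∈d → ∧-cong-T {c σ} λ σ∈c → f≡g σ∈c τ∈d) ⟩
    d τ ∧ (c σ ∧ g τ σ) ≡⟨ sym (∧-assoc (d τ) (c σ) _) ⟩
    (d τ ∧ c σ) ∧ g τ σ ≡⟨ cong (_∧ g τ σ) (∧-comm (d τ) (c σ)) ⟩
    (c σ ∧ d τ) ∧ g τ σ ≡⟨ ∧-assoc (c σ) (d τ) _ ⟩
    c σ ∧ (d τ ∧ g τ σ) ∎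

extend-extend : (f g : Subset n → Coll n) (c : Coll n) →
                extend f (extend g c) ≗ extend (λ σ → extend f (g σ)) c
-- The coefficient at `ρ` is a pairing with the column `λ τ → f τ ρ`; adjointness moves `g` onto
-- that column.
extend-extend f g c ρ = trans (extend-adjoint {g = flip g} c (λ τ → f τ ρ) (λ _ _ → refl))
                              (∑-cong λ σ → cong (c σ ∧_) (∑-cong λ τ → ∧-comm (f τ ρ) (g σ τ)))

extend-extend-∅ : (f v : Subset n → Coll n) (c : Coll n) →
                  (∀ {σ τ} → τ ∈ v σ → f τ ≗ ∅) → extend f (extend v c) ≗ ∅
extend-extend-∅ f v c f-v ρ = trans (extend-extend f v c ρ)
  (extend-∅ (λ σ → extend f (v σ)) c λ {σ} _ → false⇒¬T (extend-∅ f (v σ) λ τ∈vσ → false⇒¬T (f-v {σ} τ∈vσ ρ)))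

-- Both correction terms die: `f` vanishes on the image of `v`, and so does `f` composed with `D`.
-- With `D` and `v` abstract, one argument serves `⋏` with `∂`, `V` and `⋎` with `δ`, `V*`.
extend-flow : (f D v : Subset n → Coll n) (c : Coll n) →
              (∀ {σ τ} → τ ∈ v σ → f τ ≗ ∅) → (∀ {σ τ} → τ ∈ v σ → extend f (D τ) ≗ ∅) →
              extend f (c △ extend D (extend v c) △ extend v (extend D c)) ≗ extend f c
extend-flow f D v c f-v fD-v ρ = begin
  extend f (c △ a △ b) ρ                            ≡⟨ extend-△ f (c △ a) b ρ ⟩
  extend f (c △ a) ρ xor extend f b ρ               ≡⟨ cong₂ _xor_ (extend-△ f c a ρ) (extend-extend-∅ f v (extend D c) (λ {σ} → f-v {σ}) ρ) ⟩
  (extend f c ρ xor extend f a ρ) xor false         ≡⟨ xor-identityʳ _ ⟩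
  extend f c ρ xor extend f a ρ                     ≡⟨ cong (extend f c ρ xor_) (extend-extend f D (extend v c) ρ) ⟩
  extend f c ρ xor extend (λ τ → extend f (D τ)) (extend v c) ρ
    ≡⟨ cong (extend f c ρ xor_) (extend-extend-∅ (λ τ → extend f (D τ)) v c (λ {σ} → fD-v {σ}) ρ) ⟩
  extend f c ρ xor false                            ≡⟨ xor-identityʳ _ ⟩
  extend f c ρ                                      ∎
  where
  a = extend D (extend v c)
  b = extend v (extend D c)

≈-on-support : {S : Coll n} (c d : Chain S) → (∀ {σ} → σ ∈ S → coeff c σ ≡ coeff d σ) → c ≈ d
≈-on-support {S = S} c d eq σ with S σ in Sσ
... | true  = eq (subst T (sym Sσ) _)
... | false = trans (¬T⇒false (out c)) (sym (¬T⇒false (out d)))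
  where
  out : ∀ e → ¬ σ ∈ coeff e
  out e σ∈e = subst T Sσ (support e σ∈e)

-- Singletons of simplices in `S` are test chains that read off single coefficients. This turns
-- identities between pairings into identities between chains.
pair-nondegenerate : {S : Coll n} (c c′ : Chain S) →
                     (∀ (d : Chain S) → ⟨ coeff c , coeff d ⟩ ≡ ⟨ coeff c′ , coeff d ⟩) → c ≈ c′
pair-nondegenerate {S = S} c c′ eq = ≈-on-support c c′ λ {ν} ν∈S →
  let s = chain (singleton ν) λ {σ} t → subst (_∈ S) (sym (witness⁻ (σ ≟ ν) t)) ν∈S
  in trans (sym (pair-singleton (coeff c) ν)) (trans (eq s) (pair-singleton (coeff c′) ν))

fold-commute : (f : A → A) (x : A) → ∀ i → fold (f x) f i ≡ f (fold x f i)
fold-commute f x zero    = refl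
fold-commute f x (suc i) = cong f (fold-commute f x i)

-- Regular pairs of a Morse sequence

private variable K : Complex n

regularPair-⊆ : (W : MorseSequence K) → ∀ {σ τ} → RegularPair W σ τ → σ ⊆ τ
regularPair-⊆ (expand W _ _ e) (inj₁ (refl , refl)) = proj₁ (FreePair.σ⊂τ (Expansion.free e))
regularPair-⊆ (expand W _ _ e) (inj₂ r)             = regularPair-⊆ W r
regularPair-⊆ (fill W _ _)     r                    = regularPair-⊆ W r

lower∈K : (W : MorseSequence K) → ∀ {σ τ} → RegularPair W σ τ → σ ∈ simplices K
lower∈K W r = proj₁ (regularPair-graded W r)

upper∈K : (W : MorseSequence K) → ∀ {σ τ} → RegularPair W σ τ → τ ∈ simplices K
upper∈K W r = proj₁ (proj₂ (regularPair-graded W r))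

module _ {L K : Complex n} {σ τ : Subset n} (e : Expansion L K σ τ) where

  open FreePair (Expansion.free e)

  σ∉L : ¬ σ ∈ simplices L
  σ∉L σ∈L = proj₁ (proj₂ (Equivalence.to (Expansion.remove e σ) σ∈L)) refl

  τ∉L : ¬ τ ∈ simplices L
  τ∉L τ∈L = proj₂ (proj₂ (Equivalence.to (Expansion.remove e τ) τ∈L)) refl

  σ≢τ : σ ≢ τ
  σ≢τ refl = let _ , _ , x∈σ , x∉σ = σ⊂τ in x∉σ x∈σ

-- Simplices of the last pair lie outside `L`, whereas all earlier pairs lie in `L`, so old and new
-- pairs cannot share a simplex.
upper-unique : (W : MorseSequence K) → ∀ {σ τ τ′} → RegularPair W σ τ → RegularPair W σ τ′ → τ ≡ τ′
upper-unique (expand W _ _ e) (inj₁ (_ , refl))    (inj₁ (_ , refl))    = refl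
upper-unique (expand W _ _ e) (inj₁ (refl , refl)) (inj₂ r′)            = contradiction (lower∈K W r′) (σ∉L e)
upper-unique (expand W _ _ e) (inj₂ r)             (inj₁ (refl , refl)) = contradiction (lower∈K W r) (σ∉L e)
upper-unique (expand W _ _ e) (inj₂ r)             (inj₂ r′)            = upper-unique W r r′
upper-unique (fill W _ _)     r                    r′                   = upper-unique W r r′

lower⇒¬upper : (W : MorseSequence K) → ∀ {σ} → LowerRegular W σ → ¬ UpperRegular W σ
lower⇒¬upper (expand W _ _ e) (_ , inj₁ (refl , _)) (_ , inj₁ (_ , σ≡τ))  = σ≢τ e σ≡τ
lower⇒¬upper (expand W _ _ e) (_ , inj₁ (refl , _)) (_ , inj₂ r′)         = σ∉L e (upper∈K W r′)
lower⇒¬upper (expand W _ _ e) (_ , inj₂ r)          (_ , inj₁ (_ , refl)) = τ∉L e (lower∈K W r)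
lower⇒¬upper (expand W _ _ e) (_ , inj₂ r)          (_ , inj₂ r′)         = lower⇒¬upper W (_ , r) (_ , r′)
lower⇒¬upper (fill W _ _)     l                     u                     = lower⇒¬upper W l u

classify : (W : MorseSequence K) → ∀ {ν} → ν ∈ simplices K →
           Critical W ν ⊎ LowerRegular W ν ⊎ UpperRegular W ν
classify (start K-empty) ν∈K = contradiction ν∈K (K-empty _)
classify (expand W σ τ e) {ν} ν∈K with ν ≟ σ | ν ≟ τ
... | yes ν≡σ | _       = inj₂ (inj₁ (τ , inj₁ (ν≡σ , refl)))
... | no _    | yes ν≡τ = inj₂ (inj₂ (σ , inj₁ (refl , ν≡τ)))
... | no ν≢σ  | no ν≢τ  with classify W (Equivalence.from (Expansion.remove e ν) (ν∈K , ν≢σ , ν≢τ))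
...   | inj₁ crit            = inj₁ crit
...   | inj₂ (inj₁ (_ , r))  = inj₂ (inj₁ (_ , inj₂ r))
...   | inj₂ (inj₂ (_ , r))  = inj₂ (inj₂ (_ , inj₂ r))
classify (fill W κ f) {ν} ν∈K with ν ≟ κ
... | yes ν≡κ = inj₁ (inj₁ ν≡κ)
... | no ν≢κ  with classify W (Equivalence.from (Filling.remove f ν) (ν∈K , ν≢κ))
...   | inj₁ crit = inj₁ (inj₂ crit)
...   | inj₂ reg  = inj₂ reg

-- Ranks of regular pairs and acyclicity

height : MorseSequence K → ℕ
height (start _)        = 0
height (expand W _ _ _) = suc (height W)
height (fill W _ _)     = height W

-- The position of the pair among the expansions, counted from 0 at the start of the sequence.
rank : (W : MorseSequence K) → ∀ {σ τ} → RegularPair W σ τ → ℕ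
rank (expand W _ _ _) (inj₁ _) = height W
rank (expand W _ _ _) (inj₂ r) = rank W r
rank (fill W _ _)     r        = rank W r

rank<height : (W : MorseSequence K) → ∀ {σ τ} (r : RegularPair W σ τ) → rank W r < height W
rank<height (expand W _ _ _) (inj₁ _) = n<1+n (height W)
rank<height (expand W _ _ _) (inj₂ r) = m≤n⇒m≤1+n (rank<height W r)
rank<height (fill W _ _)     r        = rank<height W r

-- Acyclicity of the gradient field. When `τ` enters, the complex is closed and contains all its
-- nonempty subsets, so `σ′` is already there; being different from `σ`, it came with an earlier
-- pair. Successive pairs along a gradient path therefore have strictly smaller rank.
rank-decreases : (W : MorseSequence K) → ∀ {σ τ σ′ τ′}
                 (r : RegularPair W σ τ) (r′ : RegularPair W σ′ τ′) →
                 σ′ ⊆ τ → σ′ ≢ σ → rank W r′ < rank W r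
rank-decreases (expand W _ _ e) (inj₁ (refl , _)) (inj₁ (refl , _))    _    σ′≢σ = contradiction refl σ′≢σ
rank-decreases (expand W _ _ e) (inj₁ _)          (inj₂ r′)            _    _    = rank<height W r′
rank-decreases (expand {L} {K} W σ _ e) (inj₂ r)  (inj₁ (refl , _))    σ⊆τ  _    =
  contradiction (closed L (upper∈K W r) σ⊆τ (nonempty K (FreePair.σ∈K (Expansion.free e)))) (σ∉L e)
rank-decreases (expand W _ _ e) (inj₂ r)          (inj₂ r′)            σ′⊆τ σ′≢σ = rank-decreases W r r′ σ′⊆τ σ′≢σ
rank-decreases (fill W _ _)     r                 r′                   σ′⊆τ σ′≢σ = rank-decreases W r r′ σ′⊆τ σ′≢σ

-- Two different lower simplices paired with the same `τ` would each have smaller rank than the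
-- other.
lower-unique : (W : MorseSequence K) → ∀ {σ σ′ τ} → RegularPair W σ τ → RegularPair W σ′ τ → σ ≡ σ′
lower-unique W {σ} {σ′} r r′ with σ ≟ σ′
... | yes σ≡σ′ = σ≡σ′
... | no  σ≢σ′ = contradiction (rank-decreases W r r′ (regularPair-⊆ W r′) (σ≢σ′ ∘ sym))
                               (<-asym (rank-decreases W r′ r (regularPair-⊆ W r) σ≢σ′))

-- Coefficients of `∂` and `V` at regular pairs

module _ {n : ℕ} {K : Complex n} (W : MorseSequence K) where

  private
    D v : Subset n → Coll n
    D = ∂ K
    v = V W

  face⁻ : ∀ {σ τ} → τ ∈ ∂ K σ → τ ∈ simplices K × dim τ ≡ pred (dim σ) × τ ⊆ σ
  face⁻ {σ} {τ} t =
    let graded , incl = ∧⁻ {(simplices K ⁽ pred (dim σ) ⁾) τ} t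
        τ∈K , d       = graded⁻ (simplices K) τ graded
    in τ∈K , d , witness⁻ (τ ⊆? σ) incl

  face⁺ : ∀ {σ τ} → τ ∈ simplices K → dim τ ≡ pred (dim σ) → τ ⊆ σ → τ ∈ ∂ K σ
  face⁺ {σ} {τ} τ∈K d τ⊆σ = ∧⁺ (graded⁺ (simplices K) τ τ∈K d) (witness⁺ (τ ⊆? σ) τ⊆σ)

  ∂-transpose : ∀ {σ τ} → σ ∈ simplices K → τ ∈ simplices K → ∂ K σ τ ≡ δ K τ σ
  ∂-transpose {σ} {τ} σ∈K τ∈K = T-ext
    (λ t → let _ , d , τ⊆σ = face⁻ {σ} t in
      ∧⁺ (graded⁺ (simplices K) σ σ∈K (trans (sym (ℤ.suc-pred (dim σ))) (cong ℤ.suc (sym d))))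
         (witness⁺ (τ ⊆? σ) τ⊆σ))
    (λ t → let graded , incl = ∧⁻ {(simplices K ⁽ ℤ.suc (dim τ) ⁾) σ} t
               _ , d         = graded⁻ (simplices K) σ graded in
      face⁺ {σ} τ∈K (trans (sym (ℤ.pred-suc (dim τ))) (cong pred (sym d))) (witness⁻ (τ ⊆? σ) incl))

  V⁻ : ∀ {σ τ} → τ ∈ V W σ → RegularPair W σ τ
  V⁻ {σ} {τ} = witness⁻ (regularPair? W σ τ)

  regularPair-face : ∀ {σ τ} → RegularPair W σ τ → σ ∈ ∂ K τ
  regularPair-face {σ} {τ} r = let σ∈K , _ , d = regularPair-graded W r in
    face⁺ {τ} σ∈K (trans (sym (ℤ.pred-suc (dim σ))) (cong pred (sym d))) (regularPair-⊆ W r)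

  -- A simplex `σ′` of `c` reaches `σ` only if it is paired with some `τ′` containing `σ`. The
  -- hypothesis leaves only `σ` itself, which returns through its own `τ`.
  ∂V-lower : (c : Coll n) → ∀ {σ τ} → RegularPair W σ τ →
             (∀ {σ′ τ′} → RegularPair W σ′ τ′ → σ ⊆ τ′ → σ ≢ σ′ → ¬ σ′ ∈ c) →
             extend (∂ K) (extend (V W) c) σ ≡ c σ
  ∂V-lower c {σ} {τ} r only = begin
    extend D (extend v c) σ               ≡⟨ extend-extend D v c σ ⟩
    extend (λ σ′ → extend D (v σ′)) c σ   ≡⟨ extend-single (λ σ′ → extend D (v σ′)) c σ single ⟩
    c σ ∧ extend D (v σ) σ                ≡⟨ cong (c σ ∧_) (extend-single D (v σ) τ λ t _ → upper-unique W (V⁻ t) r) ⟩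
    c σ ∧ (v σ τ ∧ D τ σ)                 ≡⟨ cong₂ (λ a b → c σ ∧ (a ∧ b)) (dec-true (regularPair? W σ τ) r)
                                                                           (T⇒true (regularPair-face r)) ⟩
    c σ ∧ true                            ≡⟨ ∧-identityʳ (c σ) ⟩
    c σ                                   ∎
    where
    single : ∀ {σ′} → σ′ ∈ c → σ ∈ extend D (v σ′) → σ′ ≡ σ
    single {σ′} σ′∈c t with σ′ ≟ σ
    ... | yes σ′≡σ = σ′≡σ
    ... | no  σ′≢σ = contradiction t (false⇒¬T (extend-∅ D (v σ′) λ {τ′} r′ σ∈∂τ′ →
                       only (V⁻ r′) (proj₂ (proj₂ (face⁻ {τ′} σ∈∂τ′))) (σ′≢σ ∘ sym) σ′∈c))

  -- By `lower-unique`, `V` produces `τ` only from `σ`, so a contributing `τ′` must contain `σ`. The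
  -- hypothesis leaves only `τ` itself.
  V∂-upper : (c : Coll n) → ∀ {σ τ} → RegularPair W σ τ →
             (∀ {τ′} → σ ⊆ τ′ → τ ≢ τ′ → ¬ τ′ ∈ c) →
             extend (V W) (extend (∂ K) c) τ ≡ c τ
  V∂-upper c {σ} {τ} r only = begin
    extend v (extend D c) τ               ≡⟨ extend-extend v D c τ ⟩
    extend (λ τ′ → extend v (D τ′)) c τ   ≡⟨ extend-single (λ τ′ → extend v (D τ′)) c τ single ⟩
    c τ ∧ extend v (D τ) τ                ≡⟨ cong (c τ ∧_) (extend-single v (D τ) σ λ {σ′} _ t → lower-unique W (V⁻ {σ′} t) r) ⟩
    c τ ∧ (D τ σ ∧ v σ τ)                 ≡⟨ cong₂ (λ a b → c τ ∧ (a ∧ b)) (T⇒true (regularPair-face r))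
                                                                           (dec-true (regularPair? W σ τ) r) ⟩
    c τ ∧ true                            ≡⟨ ∧-identityʳ (c τ) ⟩
    c τ                                   ∎
    where
    single : ∀ {τ′} → τ′ ∈ c → τ ∈ extend v (D τ′) → τ′ ≡ τ
    single {τ′} τ′∈c t with τ′ ≟ τ
    ... | yes τ′≡τ = τ′≡τ
    ... | no  τ′≢τ = contradiction t (false⇒¬T (extend-∅ v (D τ′) λ {σ′} σ′∈∂τ′ r′ →
                       only (subst (_⊆ τ′) (lower-unique W (V⁻ {σ′} r′) r) (proj₂ (proj₂ (face⁻ {τ′} σ′∈∂τ′))))
                            (τ′≢τ ∘ sym) τ′∈c))

  chain⊑K : ∀ {q} (c : K [ q ]) → coeff c ⊑ simplices K
  chain⊑K c {σ} σ∈c = proj₁ (graded⁻ (simplices K) σ (support c σ∈c))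

  -- The flow

  module _ (p : ℤ) where

    Φ-cong : {c d : K [ p ]} → c ≈ d → Φ W p c ≈ Φ W p d
    Φ-cong c≈d σ = cong₂ _xor_ (cong₂ _xor_ (c≈d σ) (extend-cong D (extend-cong v c≈d) σ))
                               (extend-cong v (extend-cong D c≈d) σ)

    Φ-⊕ : (c d : K [ p ]) → Φ W p (c ⊕ d) ≈ Φ W p c ⊕ Φ W p d
    Φ-⊕ c d σ = begin
      ((c₁ σ xor d₁ σ) xor extend D (extend v (c₁ △ d₁)) σ) xor extend v (extend D (c₁ △ d₁)) σ
        ≡⟨ cong₂ (λ a b → ((c₁ σ xor d₁ σ) xor a) xor b) (additive D v) (additive v D) ⟩
      ((c₁ σ xor d₁ σ) xor (a c₁ xor a d₁)) xor (b c₁ xor b d₁)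
        ≡⟨ cong (_xor (b c₁ xor b d₁)) (xor-interchange (c₁ σ) (d₁ σ) (a c₁) (a d₁)) ⟩
      ((c₁ σ xor a c₁) xor (d₁ σ xor a d₁)) xor (b c₁ xor b d₁)
        ≡⟨ xor-interchange (c₁ σ xor a c₁) (d₁ σ xor a d₁) (b c₁) (b d₁) ⟩
      ((c₁ σ xor a c₁) xor b c₁) xor ((d₁ σ xor a d₁) xor b d₁) ∎
      where
      c₁ = coeff c
      d₁ = coeff d
      a b : Coll n → Bool
      a e = extend D (extend v e) σ
      b e = extend v (extend D e) σ
      additive : ∀ f g → extend f (extend g (c₁ △ d₁)) σ ≡ extend f (extend g c₁) σ xor extend f (extend g d₁) σ
      additive f g = trans (extend-cong f (extend-△ g c₁ d₁) σ) (extend-△ f (extend g c₁) (extend g d₁) σ)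

    -- Applied below with `d` the limit of `c`, so that the iterates of the difference `c ⊕ d`
    -- determine those of `c`.
    Φ^-⊕-fixed : ∀ c d → Φ W p d ≈ d → ∀ i → fold (c ⊕ d) (Φ W p) i ≈ fold c (Φ W p) i ⊕ d
    Φ^-⊕-fixed c d Φd≈d zero    σ = refl
    Φ^-⊕-fixed c d Φd≈d (suc i) σ = begin
      coeff (Φ W p (fold (c ⊕ d) (Φ W p) i)) σ              ≡⟨ Φ-cong {fold (c ⊕ d) (Φ W p) i} {cᵢ ⊕ d} (Φ^-⊕-fixed c d Φd≈d i) σ ⟩
      coeff (Φ W p (cᵢ ⊕ d)) σ                              ≡⟨ Φ-⊕ cᵢ d σ ⟩
      coeff (Φ W p cᵢ) σ xor coeff (Φ W p d) σ              ≡⟨ cong (coeff (Φ W p cᵢ) σ xor_) (Φd≈d σ) ⟩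
      coeff (Φ W p cᵢ) σ xor coeff d σ                      ∎
      where cᵢ = fold c (Φ W p) i

    Φ-adjoint : (c d : K [ p ]) → ⟨ coeff (Φ W p c) , coeff d ⟩ ≡ ⟨ coeff c , coeff (Φ* W p d) ⟩
    Φ-adjoint c d = begin
      ⟨ c₁ △ extend D (extend v c₁) △ extend v (extend D c₁) , d₁ ⟩
        ≡⟨ trans (pair-△ˡ (c₁ △ extend D (extend v c₁)) _ d₁) (cong (_xor ⟨ extend v (extend D c₁) , d₁ ⟩) (pair-△ˡ c₁ _ d₁)) ⟩
      (⟨ c₁ , d₁ ⟩ xor ⟨ extend D (extend v c₁) , d₁ ⟩) xor ⟨ extend v (extend D c₁) , d₁ ⟩
        ≡⟨ cong₂ (λ a b → (⟨ c₁ , d₁ ⟩ xor a) xor b) ∂V-adjoint V∂-adjoint ⟩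
      (⟨ c₁ , d₁ ⟩ xor ⟨ c₁ , extend v* (extend D* d₁) ⟩) xor ⟨ c₁ , extend D* (extend v* d₁) ⟩
        -- Transposition reverses products: `∂ V` becomes `V* δ` and `V ∂` becomes `δ V*`, so the
        -- two terms appear in the opposite order from `Φ*`.
        ≡⟨ xor-swapʳ ⟨ c₁ , d₁ ⟩ _ _ ⟩
      (⟨ c₁ , d₁ ⟩ xor ⟨ c₁ , extend D* (extend v* d₁) ⟩) xor ⟨ c₁ , extend v* (extend D* d₁) ⟩
        ≡⟨ sym (trans (pair-△ʳ c₁ (d₁ △ extend D* (extend v* d₁)) _)
                      (cong (_xor ⟨ c₁ , extend v* (extend D* d₁) ⟩) (pair-△ʳ c₁ d₁ _))) ⟩
      ⟨ c₁ , d₁ △ extend D* (extend v* d₁) △ extend v* (extend D* d₁) ⟩ ∎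
      where
      c₁ = coeff c
      d₁ = coeff d
      D* v* : Subset n → Coll n
      D* = δ K
      v* = V* W
      ∂V-adjoint : ⟨ extend D (extend v c₁) , d₁ ⟩ ≡ ⟨ c₁ , extend v* (extend D* d₁) ⟩
      ∂V-adjoint = trans
        (extend-adjoint (extend v c₁) d₁ λ σ∈ τ∈ → ∂-transpose (chain⊑K (Vₚ W p c) σ∈) (chain⊑K d τ∈))
        (extend-adjoint c₁ (extend D* d₁) λ _ _ → refl)
      V∂-adjoint : ⟨ extend v (extend D c₁) , d₁ ⟩ ≡ ⟨ c₁ , extend D* (extend v* d₁) ⟩
      V∂-adjoint = trans
        (extend-adjoint (extend D c₁) d₁ λ _ _ → refl)
        (extend-adjoint c₁ (extend v* d₁) λ σ∈ τ∈ → ∂-transpose (chain⊑K c σ∈) (chain⊑K (V*ₚ W p d) τ∈))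

    Φ^-adjoint : ∀ i (c d : K [ p ]) →
                 ⟨ coeff (fold c (Φ W p) i) , coeff d ⟩ ≡ ⟨ coeff c , coeff (fold d (Φ* W p) i) ⟩
    Φ^-adjoint zero    c d = refl
    Φ^-adjoint (suc i) c d = begin
      ⟨ coeff (Φ W p (fold c (Φ W p) i)) , coeff d ⟩    ≡⟨ Φ-adjoint (fold c (Φ W p) i) d ⟩
      ⟨ coeff (fold c (Φ W p) i) , coeff (Φ* W p d) ⟩   ≡⟨ Φ^-adjoint i c (Φ* W p d) ⟩
      -- The transposed factor arrives innermost, while `fold` adds factors on the outside.
      ⟨ coeff c , coeff (fold (Φ* W p d) (Φ* W p) i) ⟩  ≡⟨ cong (λ e → ⟨ coeff c , coeff e ⟩) (fold-commute (Φ* W p) d i) ⟩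
      ⟨ coeff c , coeff (fold d (Φ* W p) (suc i)) ⟩     ∎

    -- These measure the progress of the flow: at `k = height W` they hold for every chain, and at
    -- `k = 0` they exclude all lower, respectively upper, regular simplices.
    LowerBelow UpperBelow : ℕ → K [ p ] → Set
    LowerBelow k c = ∀ {σ τ} (r : RegularPair W σ τ) → k ≤ rank W r → ¬ σ ∈ coeff c
    UpperBelow k c = ∀ {σ τ} (r : RegularPair W σ τ) → k ≤ rank W r → ¬ τ ∈ coeff c

    -- Any other `σ′` in `c` feeding into `σ` has rank greater than that of `σ`, hence is excluded
    -- by the hypothesis. So `∂ V` returns exactly `c σ`, which cancels against the identity term,
    -- while `V ∂` yields only upper regular simplices.
    Φ-lowerBelow : ∀ {k} c → LowerBelow (suc k) c → LowerBelow k (Φ W p c)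
    Φ-lowerBelow c below {σ} {τ} r k≤r = false⇒¬T (begin
      (c₁ σ xor extend D (extend v c₁) σ) xor extend v (extend D c₁) σ
        ≡⟨ cong₂ (λ a b → (c₁ σ xor a) xor b)
             (∂V-lower c₁ r λ r′ σ⊆τ′ σ≢σ′ → below r′ (≤-<-trans k≤r (rank-decreases W r′ r σ⊆τ′ σ≢σ′)))
             (extend-∅ v (extend D c₁) λ {ρ} _ t → lower⇒¬upper W (τ , r) (ρ , V⁻ t)) ⟩
      (c₁ σ xor c₁ σ) xor false ≡⟨ xor-identityʳ _ ⟩
      c₁ σ xor c₁ σ             ≡⟨ xor-same (c₁ σ) ⟩
      false                     ∎)
      where c₁ = coeff c

    Φ^-lowerBelow : ∀ i {k} c → height W ≤ i + k → LowerBelow k (fold c (Φ W p) i)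
    Φ^-lowerBelow zero    c h≤k r k≤r = contradiction (≤-trans h≤k k≤r) (<⇒≱ (rank<height W r))
    Φ^-lowerBelow (suc i) {k} c h≤i+k = Φ-lowerBelow (fold c (Φ W p) i)
      (Φ^-lowerBelow i c (subst (height W ≤_) (sym (+-suc i k)) h≤i+k))

    -- Here `c` consists of upper regular simplices only, so `V c` is zero and the `∂ V` term
    -- disappears. At `τ`, other contributions to `V ∂` would come from upper simplices of higher
    -- rank, already absent, so `V ∂` returns `c τ` and cancels it.
    Φ-upperBelow : ∀ {k} c → LowerBelow 0 c → (∀ {ν} → Critical W ν → ¬ ν ∈ coeff c) →
                   UpperBelow (suc k) c → UpperBelow k (Φ W p c)
    Φ-upperBelow c ¬lower ¬critical below {σ} {τ} r k≤r = false⇒¬T (begin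
      (c₁ τ xor extend D (extend v c₁) τ) xor extend v (extend D c₁) τ
        ≡⟨ cong₂ (λ a b → (c₁ τ xor a) xor b)
             (extend-∅ D (extend v c₁) λ {ρ} ρ∈Vc _ →
               false⇒¬T (extend-∅ v c₁ λ σ∈c t → ¬lower (V⁻ t) z≤n σ∈c) ρ∈Vc)
             (V∂-upper c₁ r outside-c) ⟩
      (c₁ τ xor false) xor c₁ τ ≡⟨ cong (_xor c₁ τ) (xor-identityʳ (c₁ τ)) ⟩
      c₁ τ xor c₁ τ             ≡⟨ xor-same (c₁ τ) ⟩
      false                     ∎)
      where
      c₁ = coeff c
      outside-c : ∀ {τ′} → σ ⊆ τ′ → τ ≢ τ′ → ¬ τ′ ∈ c₁
      outside-c σ⊆τ′ τ≢τ′ τ′∈c with classify W (chain⊑K c τ′∈c)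
      ... | inj₁ crit             = ¬critical crit τ′∈c
      ... | inj₂ (inj₁ (_ , r′))  = ¬lower r′ z≤n τ′∈c
      ... | inj₂ (inj₂ (σ′ , r′)) =
        -- If `σ′` were `σ`, then `upper-unique` would force `τ′` to be `τ`; so the ranks differ
        -- strictly.
        below r′ (≤-<-trans k≤r (rank-decreases W r′ r σ⊆τ′ λ { refl → τ≢τ′ (upper-unique W r r′) })) τ′∈c

  -- Nilpotency of the flow on the kernel of ⋏

  module _ {⋏ ⋎ : Subset n → Coll n} (ref : IsReference W ⋏) (coref : IsCoreference W ⋎) (p : ℤ) where

    private
      module R = IsReference ref
      module C = IsCoreference coref

    ⋏-Φ : ∀ c → ⋏ₚ W ref p (Φ W p c) ≈ ⋏ₚ W ref p c
    ⋏-Φ c = extend-flow ⋏ D v (coeff c) (λ {σ} t → R.upper (σ , V⁻ t)) (λ {σ} t → R.upper-∂ (σ , V⁻ t))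

    ⋎-Φ* : ∀ c → ⋎ₚ W coref p (Φ* W p c) ≈ ⋎ₚ W coref p c
    ⋎-Φ* c = extend-flow ⋎ (δ K) (V* W) (coeff c)
      (λ {τ} {σ} t → C.lower (τ , V⁻ {σ} t)) (λ {τ} {σ} t → C.lower-δ (τ , V⁻ {σ} t))

    ⋏~-adjoint : ∀ w (d : K [ p ]) →
                 ⟨ coeff (⋏~ₚ W coref p w) , coeff d ⟩ ≡ ⟨ coeff w , coeff (⋎ₚ W coref p d) ⟩
    ⋏~-adjoint w d = extend-adjoint (coeff w) (coeff d) λ {κ} {ν} _ ν∈d →
      cong (_∧ ⋎ ν κ) (T⇒true (chain⊑K d ν∈d))

    ⋎~-adjoint : ∀ w (d : K [ p ]) →
                 ⟨ coeff (⋎~ₚ W ref p w) , coeff d ⟩ ≡ ⟨ coeff w , coeff (⋏ₚ W ref p d) ⟩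
    ⋎~-adjoint w d = extend-adjoint (coeff w) (coeff d) λ {κ} {ν} _ ν∈d →
      cong (_∧ ⋏ ν κ) (T⇒true (chain⊑K d ν∈d))

    -- Transpose of `⋎-Φ*`.
    Φ-⋏~ : ∀ w → Φ W p (⋏~ₚ W coref p w) ≈ ⋏~ₚ W coref p w
    Φ-⋏~ w = pair-nondegenerate (Φ W p u) u λ d → begin
      ⟨ coeff (Φ W p u) , coeff d ⟩                       ≡⟨ Φ-adjoint p u d ⟩
      ⟨ coeff u , coeff (Φ* W p d) ⟩                      ≡⟨ ⋏~-adjoint w (Φ* W p d) ⟩
      ⟨ coeff w , coeff (⋎ₚ W coref p (Φ* W p d)) ⟩       ≡⟨ pair-cong {c = coeff w} (λ _ → refl) (⋎-Φ* d) ⟩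
      ⟨ coeff w , coeff (⋎ₚ W coref p d) ⟩                ≡⟨ sym (⋏~-adjoint w d) ⟩
      ⟨ coeff u , coeff d ⟩                               ∎
      where u = ⋏~ₚ W coref p w

    -- Upper regular simplices contribute zero and a critical one contributes only itself. The lemma
    -- serves both the image of `⋏~` and the late iterates of `Φ`.
    ⋏-at-critical : (c : K [ p ]) → LowerBelow p 0 c →
                    ∀ {κ} → Critical W κ → coeff (⋏ₚ W ref p c) κ ≡ coeff c κ
    ⋏-at-critical c ¬lower {κ} crit = begin
      extend ⋏ (coeff c) κ  ≡⟨ extend-single ⋏ (coeff c) κ single ⟩
      coeff c κ ∧ ⋏ κ κ     ≡⟨ cong (coeff c κ ∧_) (trans (R.critical crit κ) (dec-true (κ ≟ κ) refl)) ⟩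
      coeff c κ ∧ true      ≡⟨ ∧-identityʳ _ ⟩
      coeff c κ             ∎
      where
      single : ∀ {ν} → ν ∈ coeff c → κ ∈ ⋏ ν → ν ≡ κ
      single {ν} ν∈c κ∈⋏ν with classify W (chain⊑K c ν∈c)
      ... | inj₁ ν-crit         = sym (witness⁻ (κ ≟ ν) (subst T (R.critical ν-crit κ) κ∈⋏ν))
      ... | inj₂ (inj₁ (_ , r)) = contradiction ν∈c (¬lower r z≤n)
      ... | inj₂ (inj₂ upper)   = contradiction κ∈⋏ν (false⇒¬T (R.upper upper κ))

    -- Since `⋎` vanishes on lower regular simplices, the image of `⋏~` contains none, and `⋏` reads
    -- off its critical part. That part is `w`, because `⋎` fixes critical simplices.
    ⋏-⋏~ : ∀ w → ⋏ₚ W ref p (⋏~ₚ W coref p w) ≈ w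
    ⋏-⋏~ w = ≈-on-support (⋏ₚ W ref p u) w λ {κ} κ∈Ŵ →
      let κ∈K⁽p⁾ , crit? = ∧⁻ {(simplices K ⁽ p ⁾) κ} κ∈Ŵ
          κ∈K            = proj₁ (graded⁻ (simplices K) κ κ∈K⁽p⁾)
          crit           = witness⁻ (critical? W κ) crit?
      in trans (⋏-at-critical u ¬lower crit) (at-critical κ∈K crit)
      where
      u = ⋏~ₚ W coref p w
      f : Subset n → Coll n
      f κ ν = simplices K ν ∧ ⋎ ν κ
      ¬lower : LowerBelow p 0 u
      ¬lower {σ} r _ = false⇒¬T (extend-∅ f (coeff w) λ {κ} _ t →
        false⇒¬T (C.lower (_ , r) κ) (proj₂ (∧⁻ {simplices K σ} t)))
      at-critical : ∀ {κ} → κ ∈ simplices K → Critical W κ → coeff u κ ≡ coeff w κ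
      at-critical {κ} κ∈K crit = begin
        extend f (coeff w) κ                    ≡⟨ extend-single f (coeff w) κ (λ {κ′} _ t →
                                                     witness⁻ (κ′ ≟ κ) (subst T (C.critical crit κ′) (proj₂ (∧⁻ {simplices K κ} t)))) ⟩
        coeff w κ ∧ (simplices K κ ∧ ⋎ κ κ)     ≡⟨ cong₂ (λ a b → coeff w κ ∧ (a ∧ b)) (T⇒true κ∈K)
                                                     (trans (C.critical crit κ) (dec-true (κ ≟ κ) refl)) ⟩
        coeff w κ ∧ true                        ≡⟨ ∧-identityʳ _ ⟩
        coeff w κ                               ∎

    ⋏-Φ^ : ∀ i c → ⋏ₚ W ref p (fold c (Φ W p) i) ≈ ⋏ₚ W ref p c
    ⋏-Φ^ zero    c σ = refl
    ⋏-Φ^ (suc i) c σ = trans (⋏-Φ (fold c (Φ W p) i) σ) (⋏-Φ^ i c σ)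

    module _ (c : K [ p ]) (⋏c≗∅ : coeff (⋏ₚ W ref p c) ≗ ∅) where

      -- The first `height W` steps clear the lower regular simplices; the `j` further steps,
      -- counted separately for the second phase, keep them absent.
      Φ^-¬lower : ∀ j → LowerBelow p 0 (fold c (Φ W p) (j + height W))
      Φ^-¬lower j = Φ^-lowerBelow p (j + height W) c (≤-trans (m≤n+m (height W) j) (m≤m+n _ 0))

      -- The critical part is the value of `⋏`, which `Φ` preserves and which is zero on `c`.
      Φ^-¬critical : ∀ j {ν} → Critical W ν → ¬ ν ∈ coeff (fold c (Φ W p) (j + height W))
      Φ^-¬critical j {ν} crit = false⇒¬T (trans (sym (⋏-at-critical (fold c (Φ W p) (j + height W)) (Φ^-¬lower j) crit))
                                                (trans (⋏-Φ^ (j + height W) c ν) (⋏c≗∅ ν)))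

      -- Second phase, starting at iterate `height W`: every later iterate is free of lower regular
      -- and critical simplices, so each step lowers the rank bound by one.
      Φ^-upperBelow : ∀ j {k} → height W ≤ j + k → UpperBelow p k (fold c (Φ W p) (j + height W))
      Φ^-upperBelow zero    h≤k r k≤r = contradiction (≤-trans h≤k k≤r) (<⇒≱ (rank<height W r))
      Φ^-upperBelow (suc j) {k} h≤j+k = Φ-upperBelow p (fold c (Φ W p) (j + height W)) (Φ^-¬lower j) (Φ^-¬critical j)
        (Φ^-upperBelow j (subst (height W ≤_) (sym (+-suc j k)) h≤j+k))

      Φ^-nilpotent : coeff (fold c (Φ W p) (height W + height W)) ≗ ∅
      Φ^-nilpotent ν = ¬T⇒false λ ν∈ → excluded ν∈ (classify W (chain⊑K (fold c (Φ W p) (height W + height W)) ν∈))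
        where
        excluded : ν ∈ coeff (fold c (Φ W p) (height W + height W)) →
                   ¬ (Critical W ν ⊎ LowerRegular W ν ⊎ UpperRegular W ν)
        excluded ν∈ (inj₁ crit)           = Φ^-¬critical (height W) crit ν∈
        excluded ν∈ (inj₂ (inj₁ (_ , r))) = Φ^-¬lower (height W) r z≤n ν∈
        excluded ν∈ (inj₂ (inj₂ (_ , r))) = Φ^-upperBelow (height W) (m≤m+n (height W) 0) r z≤n ν∈

    -- Stabilisation of the flow and transfer to the coflow

    private
      g g* : K [ p ] → K [ p ]
      g  = ⋏~ₚ W coref p ∘ ⋏ₚ W ref p
      g* = ⋎~ₚ W ref p ∘ ⋎ₚ W coref p

    -- As `⋏` is a left inverse of `⋏~`, the chain `c ⊕ g c` lies in the kernel of `⋏` and is killed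
    -- after `2h` steps, where `h` is `height W`; as `g c` is fixed by `Φ`, what remains is the
    -- iterate of `c` plus `g c`.
    Φ^-stable : ∀ c → fold c (Φ W p) (height W + height W) ≈ g c
    Φ^-stable c σ = xor≡false⇒≡ _ _ (trans (sym (Φ^-⊕-fixed p c (g c) (Φ-⋏~ (⋏ₚ W ref p c)) (height W + height W) σ))
                                           (Φ^-nilpotent (c ⊕ g c) ⋏-kernel σ))
      where
      ⋏-kernel : coeff (⋏ₚ W ref p (c ⊕ g c)) ≗ ∅
      ⋏-kernel κ = begin
        extend ⋏ (coeff c △ coeff (g c)) κ                    ≡⟨ extend-△ ⋏ (coeff c) (coeff (g c)) κ ⟩
        extend ⋏ (coeff c) κ xor extend ⋏ (coeff (g c)) κ     ≡⟨ cong (extend ⋏ (coeff c) κ xor_) (⋏-⋏~ (⋏ₚ W ref p c) κ) ⟩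
        extend ⋏ (coeff c) κ xor extend ⋏ (coeff c) κ         ≡⟨ xor-same (extend ⋏ (coeff c) κ) ⟩
        false                                                 ∎

    Φ^-stable⁺ : ∀ c → fold c (Φ W p) (suc (height W + height W)) ≈ g c
    Φ^-stable⁺ c σ = trans (Φ-cong p {fold c (Φ W p) (height W + height W)} {g c} (Φ^-stable c) σ)
                           (Φ-⋏~ (⋏ₚ W ref p c) σ)

    -- Both sides equal the pairing of `⋏ c` with `⋎ d`, so `g*` is the transpose of `g`.
    g-adjoint : ∀ c d → ⟨ coeff (g c) , coeff d ⟩ ≡ ⟨ coeff (g* d) , coeff c ⟩
    g-adjoint c d = begin
      ⟨ coeff (g c) , coeff d ⟩                                     ≡⟨ ⋏~-adjoint (⋏ₚ W ref p c) d ⟩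
      ⟨ coeff (⋏ₚ W ref p c) , coeff (⋎ₚ W coref p d) ⟩             ≡⟨ pair-comm (coeff (⋏ₚ W ref p c)) (coeff (⋎ₚ W coref p d)) ⟩
      ⟨ coeff (⋎ₚ W coref p d) , coeff (⋏ₚ W ref p c) ⟩             ≡⟨ sym (⋎~-adjoint (⋎ₚ W coref p d) c) ⟩
      ⟨ coeff (g* d) , coeff c ⟩                                    ∎

    -- The exponent is a parameter because stationarity of `Φ*` takes this at two consecutive
    -- exponents.
    Φ*^-stable : ∀ i → (∀ c → fold c (Φ W p) i ≈ g c) → ∀ d → fold d (Φ* W p) i ≈ g* d
    Φ*^-stable i stable d = pair-nondegenerate (fold d (Φ* W p) i) (g* d) λ c → begin
      ⟨ coeff (fold d (Φ* W p) i) , coeff c ⟩  ≡⟨ pair-comm (coeff (fold d (Φ* W p) i)) (coeff c) ⟩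
      ⟨ coeff c , coeff (fold d (Φ* W p) i) ⟩  ≡⟨ sym (Φ^-adjoint p i c d) ⟩
      ⟨ coeff (fold c (Φ W p) i) , coeff d ⟩   ≡⟨ pair-cong {d = coeff d} (stable c) (λ _ → refl) ⟩
      ⟨ coeff (g c) , coeff d ⟩                ≡⟨ g-adjoint c d ⟩
      ⟨ coeff (g* d) , coeff c ⟩               ∎

theorem13 : {n : ℕ} {K : Complex n} (W : MorseSequence K)
    {⋏ ⋎ : Subset n → Coll n} (ref : IsReference W ⋏) (coref : IsCoreference W ⋎)
    (p : ℤ) →
    (Φ W p StabilisesTo (⋏~ₚ W coref p ∘ ⋏ₚ W ref p)) ×
    (Φ* W p StabilisesTo (⋎~ₚ W ref p ∘ ⋎ₚ W coref p))
theorem13 W ref coref p =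
  (λ c → i , (λ σ → trans (stable⁺ c σ) (sym (stable c σ))) , λ σ → sym (stable c σ)) ,
  (λ c → i , (λ σ → trans (costable (suc i) stable⁺ c σ) (sym (costable i stable c σ))) ,
             λ σ → sym (costable i stable c σ))
  where
  -- One `height W` clears the lower regular simplices and one the upper; the exponent is the same
  -- for all chains.
  i        = height W + height W
  stable   = Φ^-stable W ref coref p
  stable⁺  = Φ^-stable⁺ W ref coref p
  costable = Φ*^-stable W ref coref p
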